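{- Let $n\in\mathbb{N}$, $n>1$, and let $f\in\mathcal{A}$, $g\in\mathcal{M}$, $h\in\mathcal{I}$. For $x,y\in\mathbb{Z}$ define $d^{(n)}_{(f,+)}(x,y)=d^{(n)}_{(g,+)}(x,y)=d^{(n)}_{(h,+)}(x,y)=0$ if $x=y$, and, if $x\neq y$, $$d^{(n)}_{(f,+)}(x,y)=f(\gcd(x,n))+f(\gcd(y,n)),$$ $$d^{(n)}_{(g,+)}(x,y)=g(\gcd(x,n))+g(\gcd(y,n))-2,$$ $$d^{(n)}_{(h,+)}(x,y)=2-h(\gcd(x,n))-h(\gcd(y,n)).$$ Then $d^{(n)}_{(f,+)}$, $d^{(n)}_{(g,+)}$ and $d^{(n)}_{(h,+)}$ are pseudometrics on $\mathbb{Z}$, and so also on $D_n$. If $f\in\mathcal{A}_0$, $g\in\mathcal{M}_1$ and $h\in\mathcal{I}_1$, then they are metrics on $D_n$.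
   Context: $\mathbb{N}$ is the set of positive integers and $D_n=\{x\in\mathbb{N}: x\mid n\}$. A function $f:\mathbb{N}\to\mathbb{R}$ is additive if $f(xy)=f(x)+f(y)$ for all coprime $x,y$; $g:\mathbb{N}\to\mathbb{R}$ is multiplicative if $g$ is not identically zero and $g(xy)=g(x)g(y)$ for all coprime $x,y$. In the following sets the inequalities are required for all $x\in\mathbb{N}$, $x>1$: $\mathcal{A}=\{f\text{ additive}: f(x)\ge0\}$, $\mathcal{A}_0=\{f\in\mathcal{A}: f(x)>0\}$; $\mathcal{M}=\{g\text{ multiplicative}: g(x)\ge1\}$, $\mathcal{M}_1=\{g\in\mathcal{M}: g(x)>1\}$; $\mathcal{I}=\{h\text{ multiplicative}: 0\le h(x)\le1\}$, $\mathcal{I}_1=\{h\in\mathcal{I}: 0\le h(x)<1\}$. A pseudometric on $S$ is a function $d:S\times S\to\mathbb{R}$ with $d(x,x)=0$, $d(x,y)=d(y,x)$ and $d(x,z)\le d(x,y)+d(y,z)$; it is a metric if moreover $d(x,y)=0\Rightarrow x=y$. -}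

module Defs where

open import Data.Bool.Base using (if_then_else_)
open import Data.Integer.Base as ℤ using (ℤ)
import Data.Integer.Properties as ℤ
open import Data.Nat.Base as ℕ using (ℕ; NonZero)
open import Data.Nat.Coprimality using (Coprime)
open import Data.Nat.Divisibility using (_∣_)
open import Data.Nat.GCD using (gcd; gcd[m,n]≢0)
import Data.Nat.Properties as ℕ
open import Data.Product.Base using (_×_; _,_; ∃-syntax)
open import Data.Rational.Base as ℚ using (ℚ; 0ℚ; 1ℚ; ½)
import Data.Rational.Properties as ℚ
open import Data.Rational.Solver using (module +-*-Solver)
open import Data.Refinement.Base using (Refinement; value)
open import Data.Sum.Base using (inj₂)
open import Function.Base using (_on_)
open import Function.Metric.Core using (DistanceFunction)
open import Function.Metric.Definitions
  using (Indiscernable; Symmetric; TriangleInequality)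
open import Relation.Binary.PropositionalEquality
  using (_≡_; refl; sym; trans; cong; subst)
open import Relation.Nullary.Decidable.Core using (does)
open import Relation.Nullary.Negation.Core using (¬_)

-- A real number is a Cauchy sequence of rationals with its modulus of
-- convergence; equality of reals is _≃_, never _≡_.

Cauchy : (ℕ → ℚ) → Set
Cauchy s = ∀ ε → 0ℚ ℚ.< ε →
  ∃[ N ] ∀ m n → N ℕ.≤ m → N ℕ.≤ n → ℚ.∣ s m ℚ.- s n ∣ ℚ.< ε

record ℝ : Set where
  constructor mkℝ
  field
    seq    : ℕ → ℚ
    cauchy : Cauchy seq

open ℝ public

infix 4 _≃_ _≤_ _<_

_≃_ : ℝ → ℝ → Set
x ≃ y = ∀ ε → 0ℚ ℚ.< ε →
  ∃[ N ] ∀ n → N ℕ.≤ n → ℚ.∣ seq x n ℚ.- seq y n ∣ ℚ.< ε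

_≤_ : ℝ → ℝ → Set
x ≤ y = ∀ ε → 0ℚ ℚ.< ε →
  ∃[ N ] ∀ n → N ℕ.≤ n → seq x n ℚ.< seq y n ℚ.+ ε

_<_ : ℝ → ℝ → Set
x < y = ∃[ ε ] 0ℚ ℚ.< ε ×
  (∃[ N ] ∀ n → N ℕ.≤ n → seq x n ℚ.+ ε ℚ.< seq y n)

0<½* : ∀ {ε} → 0ℚ ℚ.< ε → 0ℚ ℚ.< ½ ℚ.* ε
0<½* {ε} 0<ε = subst (ℚ._< ½ ℚ.* ε) (ℚ.*-zeroʳ ½) (ℚ.*-monoʳ-<-pos ½ 0<ε)

halves : ∀ ε → ½ ℚ.* ε ℚ.+ ½ ℚ.* ε ≡ ε
halves = solve 1 (λ ε → con ½ :* ε :+ con ½ :* ε := ε) refl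
  where open +-*-Solver

∣p-p∣<ε : ∀ p {ε} → 0ℚ ℚ.< ε → ℚ.∣ p ℚ.- p ∣ ℚ.< ε
∣p-p∣<ε p {ε} 0<ε = subst (λ q → ℚ.∣ q ∣ ℚ.< ε) (sym (ℚ.+-inverseʳ p)) 0<ε

+-cauchy : ∀ s t → Cauchy s → Cauchy t → Cauchy (λ n → s n ℚ.+ t n)
+-cauchy s t cs ct ε 0<ε
  with M , p ← cs (½ ℚ.* ε) (0<½* 0<ε)
  with N , q ← ct (½ ℚ.* ε) (0<½* 0<ε)
  = M ℕ.⊔ N , λ m n M⊔N≤m M⊔N≤n → begin-strict
    ℚ.∣ (s m ℚ.+ t m) ℚ.- (s n ℚ.+ t n) ∣
      ≡⟨ cong ℚ.∣_∣ (rearrange (s m) (t m) (s n) (t n)) ⟩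
    ℚ.∣ (s m ℚ.- s n) ℚ.+ (t m ℚ.- t n) ∣
      ≤⟨ ℚ.∣p+q∣≤∣p∣+∣q∣ (s m ℚ.- s n) (t m ℚ.- t n) ⟩
    ℚ.∣ s m ℚ.- s n ∣ ℚ.+ ℚ.∣ t m ℚ.- t n ∣
      <⟨ ℚ.+-mono-< (p m n (ℕ.m⊔n≤o⇒m≤o M N M⊔N≤m) (ℕ.m⊔n≤o⇒m≤o M N M⊔N≤n))
                    (q m n (ℕ.m⊔n≤o⇒n≤o M N M⊔N≤m) (ℕ.m⊔n≤o⇒n≤o M N M⊔N≤n)) ⟩
    ½ ℚ.* ε ℚ.+ ½ ℚ.* ε
      ≡⟨ halves ε ⟩
    ε ∎
  where
  open ℚ.≤-Reasoning
  open +-*-Solver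
  rearrange : ∀ a b c d →
    (a ℚ.+ b) ℚ.- (c ℚ.+ d) ≡ (a ℚ.- c) ℚ.+ (b ℚ.- d)
  rearrange = solve 4
    (λ a b c d → (a :+ b) :- (c :+ d) := (a :- c) :+ (b :- d)) refl

neg-cauchy : ∀ s → Cauchy s → Cauchy (λ n → ℚ.- s n)
neg-cauchy s cs ε 0<ε with N , p ← cs ε 0<ε
  = N , λ m n N≤m N≤n →
    subst (λ q → ℚ.∣ q ∣ ℚ.< ε) (swap (s n) (s m)) (p n m N≤n N≤m)
  where
  open +-*-Solver
  swap : ∀ a b → a ℚ.- b ≡ (ℚ.- b) ℚ.- (ℚ.- a)
  swap = solve 2 (λ a b → a :- b := (:- b) :- (:- a)) refl

bounded : ∀ s → Cauchy s → ∃[ B ] 0ℚ ℚ.< B ×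
  (∃[ N ] ∀ n → N ℕ.≤ n → ℚ.∣ s n ∣ ℚ.≤ B)
bounded s cs with N , p ← cs 1ℚ (ℚ.positive⁻¹ 1ℚ)
  = 1ℚ ℚ.+ ℚ.∣ s N ∣
  , ℚ.+-mono-<-≤ (ℚ.positive⁻¹ 1ℚ) (ℚ.0≤∣p∣ (s N))
  , N , λ n N≤n → begin
    ℚ.∣ s n ∣                          ≡⟨ cong ℚ.∣_∣ (split (s n) (s N)) ⟩
    ℚ.∣ (s n ℚ.- s N) ℚ.+ s N ∣        ≤⟨ ℚ.∣p+q∣≤∣p∣+∣q∣ (s n ℚ.- s N) (s N) ⟩
    ℚ.∣ s n ℚ.- s N ∣ ℚ.+ ℚ.∣ s N ∣    ≤⟨ ℚ.+-monoˡ-≤ ℚ.∣ s N ∣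
                                            (ℚ.<⇒≤ (p n N N≤n ℕ.≤-refl)) ⟩
    1ℚ ℚ.+ ℚ.∣ s N ∣                   ∎
  where
  open ℚ.≤-Reasoning
  open +-*-Solver
  split : ∀ a b → a ≡ (a ℚ.- b) ℚ.+ b
  split = solve 2 (λ a b → a := (a :- b) :+ b) refl

scaled : ∀ s → Cauchy s → ∀ B → 0ℚ ℚ.< B → ∀ ε → 0ℚ ℚ.< ε →
  ∃[ N ] ∀ m n → N ℕ.≤ m → N ℕ.≤ n → ∀ r → ℚ.∣ r ∣ ℚ.≤ B →
  ℚ.∣ r ℚ.* (s m ℚ.- s n) ∣ ℚ.< ε
scaled s cs B 0<B ε 0<ε = bound (cs (ℚ.1/ B ℚ.* ε) 0<δ)
  where
  open ℚ.≤-Reasoning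
  instance
    B-pos : ℚ.Positive B
    B-pos = ℚ.positive 0<B
    B-nonZero : ℚ.NonZero B
    B-nonZero = ℚ.pos⇒nonZero B
    1/B-pos : ℚ.Positive (ℚ.1/ B)
    1/B-pos = ℚ.1/pos⇒pos B
  0<δ : 0ℚ ℚ.< ℚ.1/ B ℚ.* ε
  0<δ = subst (ℚ._< ℚ.1/ B ℚ.* ε) (ℚ.*-zeroʳ (ℚ.1/ B))
    (ℚ.*-monoʳ-<-pos (ℚ.1/ B) 0<ε)
  cancel : B ℚ.* (ℚ.1/ B ℚ.* ε) ≡ ε
  cancel = trans (sym (ℚ.*-assoc B (ℚ.1/ B) ε))
    (trans (cong (ℚ._* ε) (ℚ.*-inverseʳ B)) (ℚ.*-identityˡ ε))
  bound : (∃[ N ] ∀ m n → N ℕ.≤ m → N ℕ.≤ n →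
             ℚ.∣ s m ℚ.- s n ∣ ℚ.< ℚ.1/ B ℚ.* ε) →
    ∃[ N ] ∀ m n → N ℕ.≤ m → N ℕ.≤ n → ∀ r → ℚ.∣ r ∣ ℚ.≤ B →
    ℚ.∣ r ℚ.* (s m ℚ.- s n) ∣ ℚ.< ε
  bound (N , p) = N , λ m n N≤m N≤n r ∣r∣≤B → begin-strict
    ℚ.∣ r ℚ.* (s m ℚ.- s n) ∣          ≡⟨ ℚ.∣p*q∣≡∣p∣*∣q∣ r (s m ℚ.- s n) ⟩
    ℚ.∣ r ∣ ℚ.* ℚ.∣ s m ℚ.- s n ∣
      ≤⟨ ℚ.*-monoʳ-≤-nonNeg ℚ.∣ s m ℚ.- s n ∣
           {{ℚ.∣-∣-nonNeg (s m ℚ.- s n)}} ∣r∣≤B ⟩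
    B ℚ.* ℚ.∣ s m ℚ.- s n ∣            <⟨ ℚ.*-monoʳ-<-pos B (p m n N≤m N≤n) ⟩
    B ℚ.* (ℚ.1/ B ℚ.* ε)               ≡⟨ cancel ⟩
    ε                                  ∎

∣ab-cd∣<ε : ∀ a b c d ε →
  ℚ.∣ a ℚ.* (b ℚ.- d) ∣ ℚ.< ½ ℚ.* ε → ℚ.∣ d ℚ.* (a ℚ.- c) ∣ ℚ.< ½ ℚ.* ε →
  ℚ.∣ a ℚ.* b ℚ.- c ℚ.* d ∣ ℚ.< ε
∣ab-cd∣<ε a b c d ε p q = begin-strict
  ℚ.∣ a ℚ.* b ℚ.- c ℚ.* d ∣
    ≡⟨ cong ℚ.∣_∣ (rearrange a b c d) ⟩
  ℚ.∣ a ℚ.* (b ℚ.- d) ℚ.+ d ℚ.* (a ℚ.- c) ∣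
    ≤⟨ ℚ.∣p+q∣≤∣p∣+∣q∣ (a ℚ.* (b ℚ.- d)) (d ℚ.* (a ℚ.- c)) ⟩
  ℚ.∣ a ℚ.* (b ℚ.- d) ∣ ℚ.+ ℚ.∣ d ℚ.* (a ℚ.- c) ∣
    <⟨ ℚ.+-mono-< p q ⟩
  ½ ℚ.* ε ℚ.+ ½ ℚ.* ε
    ≡⟨ halves ε ⟩
  ε ∎
  where
  open ℚ.≤-Reasoning
  open +-*-Solver
  rearrange : ∀ a b c d →
    a ℚ.* b ℚ.- c ℚ.* d ≡ a ℚ.* (b ℚ.- d) ℚ.+ d ℚ.* (a ℚ.- c)
  rearrange = solve 4
    (λ a b c d → a :* b :- c :* d := a :* (b :- d) :+ d :* (a :- c)) refl

*-cauchy : ∀ s t → Cauchy s → Cauchy t → Cauchy (λ n → s n ℚ.* t n)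
*-cauchy s t cs ct ε 0<ε =
  let A , 0<A , K , s≤A = bounded s cs
      B , 0<B , L , t≤B = bounded t ct
      M , p = scaled t ct A 0<A (½ ℚ.* ε) (0<½* 0<ε)
      N , q = scaled s cs B 0<B (½ ℚ.* ε) (0<½* 0<ε)
  in (K ℕ.⊔ L) ℕ.⊔ (M ℕ.⊔ N) , λ m n ≤m ≤n →
    let KL≤m = ℕ.m⊔n≤o⇒m≤o (K ℕ.⊔ L) (M ℕ.⊔ N) ≤m
        KL≤n = ℕ.m⊔n≤o⇒m≤o (K ℕ.⊔ L) (M ℕ.⊔ N) ≤n
        MN≤m = ℕ.m⊔n≤o⇒n≤o (K ℕ.⊔ L) (M ℕ.⊔ N) ≤m
        MN≤n = ℕ.m⊔n≤o⇒n≤o (K ℕ.⊔ L) (M ℕ.⊔ N) ≤n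
    in ∣ab-cd∣<ε (s m) (t m) (s n) (t n) ε
      (p m n (ℕ.m⊔n≤o⇒m≤o M N MN≤m) (ℕ.m⊔n≤o⇒m≤o M N MN≤n)
         (s m) (s≤A m (ℕ.m⊔n≤o⇒m≤o K L KL≤m)))
      (q m n (ℕ.m⊔n≤o⇒n≤o M N MN≤m) (ℕ.m⊔n≤o⇒n≤o M N MN≤n)
         (t n) (t≤B n (ℕ.m⊔n≤o⇒n≤o K L KL≤n)))

fromℚ : ℚ → ℝ
fromℚ p = mkℝ (λ _ → p) λ ε 0<ε → 0 , λ _ _ _ _ → ∣p-p∣<ε p 0<ε

0ℝ 1ℝ 2ℝ : ℝ
0ℝ = fromℚ 0ℚ
1ℝ = fromℚ 1ℚ
2ℝ = fromℚ (1ℚ ℚ.+ 1ℚ)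

infixl 6 _+_ _-_
infixl 7 _*_
infix  8 -_

_+_ : ℝ → ℝ → ℝ
x + y = mkℝ (λ n → seq x n ℚ.+ seq y n) (+-cauchy (seq x) (seq y) (cauchy x) (cauchy y))

_*_ : ℝ → ℝ → ℝ
x * y = mkℝ (λ n → seq x n ℚ.* seq y n) (*-cauchy (seq x) (seq y) (cauchy x) (cauchy y))

-_ : ℝ → ℝ
- x = mkℝ (λ n → ℚ.- seq x n) (neg-cauchy (seq x) (cauchy x))

_-_ : ℝ → ℝ → ℝ
x - y = x + (- y)

-- The irrelevant instance argument makes the domain exactly the positive
-- integers.
ArithmeticFunction : Set
ArithmeticFunction = (x : ℕ) .{{_ : NonZero x}} → ℝ

Additive : ArithmeticFunction → Set
Additive f = ∀ x y .{{_ : NonZero x}} .{{_ : NonZero y}} → Coprime x y →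
  f (x ℕ.* y) {{ℕ.m*n≢0 x y}} ≃ f x + f y

Multiplicative : ArithmeticFunction → Set
Multiplicative g =
  ¬ (∀ x .{{_ : NonZero x}} → g x ≃ 0ℝ) ×
  (∀ x y .{{_ : NonZero x}} .{{_ : NonZero y}} → Coprime x y →
    g (x ℕ.* y) {{ℕ.m*n≢0 x y}} ≃ g x * g y)

𝒜 𝒜₀ ℳ ℳ₁ ℐ ℐ₁ : ArithmeticFunction → Set
𝒜  f = Additive f       × (∀ x .{{_ : NonZero x}} → x ℕ.> 1 → 0ℝ ≤ f x)
𝒜₀ f = 𝒜 f              × (∀ x .{{_ : NonZero x}} → x ℕ.> 1 → 0ℝ < f x)
ℳ  g = Multiplicative g × (∀ x .{{_ : NonZero x}} → x ℕ.> 1 → 1ℝ ≤ g x)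
ℳ₁ g = ℳ g              × (∀ x .{{_ : NonZero x}} → x ℕ.> 1 → 1ℝ < g x)
ℐ  h = Multiplicative h × (∀ x .{{_ : NonZero x}} → x ℕ.> 1 → 0ℝ ≤ h x × h x ≤ 1ℝ)
ℐ₁ h = ℐ h              × (∀ x .{{_ : NonZero x}} → x ℕ.> 1 → 0ℝ ≤ h x × h x < 1ℝ)

record IsPseudometric {S : Set} (d : DistanceFunction S ℝ) : Set where
  field
    d[x,x]≃0 : ∀ x → d x x ≃ 0ℝ
    symmetric : Symmetric _≃_ d
    triangle  : TriangleInequality _≤_ _+_ d

record IsMetric {S : Set} (d : DistanceFunction S ℝ) : Set where
  field
    isPseudometric : IsPseudometric d
    indiscernable  : Indiscernable _≡_ _≃_ d 0ℝ

-- The proof component is irrelevant, so _≡_ on D n is equality of the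
-- underlying integers.
D : ℕ → Set
D n = Refinement ℕ λ x → NonZero x × x ∣ n

restrict : ∀ n → DistanceFunction ℤ ℝ → DistanceFunction (D n) ℝ
restrict n d = d on λ x → ℤ.+ value x

module _ (n : ℕ) .{{_ : NonZero n}} where

  atGcd : ArithmeticFunction → ℤ → ℝ
  atGcd f x = f (gcd ℤ.∣ x ∣ n)
    {{ℕ.≢-nonZero (gcd[m,n]≢0 ℤ.∣ x ∣ n (inj₂ (ℕ.≢-nonZero⁻¹ n)))}}

  d⁺-𝒜 d⁺-ℳ d⁺-ℐ : ArithmeticFunction → DistanceFunction ℤ ℝ
  d⁺-𝒜 f x y = if does (x ℤ.≟ y) then 0ℝ else atGcd f x + atGcd f y
  d⁺-ℳ g x y = if does (x ℤ.≟ y) then 0ℝ else atGcd g x + atGcd g y - 2ℝ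
  d⁺-ℐ h x y = if does (x ℤ.≟ y) then 0ℝ else 2ℝ - atGcd h x - atGcd h y

{-# OPTIONS --safe #-}

-- Each of the three distances is, off the diagonal, F (gcd x n) + F (gcd y n)
-- with F = f, g - 1, 1 - h respectively, and such a function is a pseudometric
-- as soon as F ≥ 0.  At arguments > 1 this is assumed; at 1 it comes from
-- f 1 = f 1 + f 1, g 2 = g 1 g 2 and h 1 = h 1 h 1.  On D n we have gcd x n = x,
-- and of two distinct divisors at least one exceeds 1, where F > 0.

module Submission where

open import Defs
open import Data.Bool.Base using (if_then_else_)
open import Data.Integer.Base as ℤ using (ℤ)
import Data.Integer.Properties as ℤ
open import Data.Irrelevant using ([_])
open import Data.Nat.Base as ℕ using (ℕ; NonZero; _>_)
open import Data.Nat.Coprimality using (1-coprimeTo)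
open import Data.Nat.Divisibility using (_∣_; ∣-antisym; ∣-refl)
open import Data.Nat.GCD using (gcd; gcd[m,n]∣m; gcd-greatest; gcd[m,n]≢0)
import Data.Nat.Properties as ℕ
open import Data.Product.Base using (_×_; _,_; proj₁; proj₂)
open import Data.Rational.Base as ℚ using (0ℚ; 1ℚ; ½)
import Data.Rational.Properties as ℚ
open import Data.Rational.Solver using (module +-*-Solver)
open import Data.Refinement.Base using (value; _,_)
open import Data.Refinement.Properties using (value-injective)
open import Data.Sum.Base using (_⊎_; inj₁; inj₂; [_,_]′)
open import Function.Base using (_on_)
open import Function.Metric.Core using (DistanceFunction)
open import Relation.Binary.Definitions using (DecidableEquality)
open import Relation.Binary.PropositionalEquality
  using (_≡_; _≢_; refl; sym; trans; cong; subst; subst₂)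
open import Relation.Nullary.Decidable
  using (Dec; does; yes; no; recompute; dec-true; dec-false)
open import Relation.Nullary.Negation.Core using (¬_; contradiction)

open +-*-Solver

-- Rational inequalities

p≤∣p∣ : ∀ p → p ℚ.≤ ℚ.∣ p ∣
p≤∣p∣ p with ℚ.≤-total 0ℚ p
... | inj₁ 0≤p = ℚ.≤-reflexive (sym (ℚ.0≤p⇒∣p∣≡p 0≤p))
... | inj₂ p≤0 = ℚ.≤-trans p≤0 (ℚ.0≤∣p∣ p)

∣p-q∣≡∣q-p∣ : ∀ p q → ℚ.∣ p ℚ.- q ∣ ≡ ℚ.∣ q ℚ.- p ∣
∣p-q∣≡∣q-p∣ p q = trans
  (cong ℚ.∣_∣ (solve 2 (λ p q → p :- q := :- (q :- p)) refl p q))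
  (ℚ.∣-p∣≡∣p∣ (q ℚ.- p))

p-q+q : ∀ p q → (p ℚ.- q) ℚ.+ q ≡ p
p-q+q = solve 2 (λ p q → (p :- q) :+ q := p) refl

+-halves : ∀ p q ε →
  (p ℚ.+ ½ ℚ.* ε) ℚ.+ (q ℚ.+ ½ ℚ.* ε) ≡ (p ℚ.+ q) ℚ.+ ε
+-halves = solve 3
  (λ p q ε → (p :+ con ½ :* ε) :+ (q :+ con ½ :* ε) := (p :+ q) :+ ε) refl

-- Only the difference of the two sides matters, so an inequality can be rearranged by one ring
-- identity handed to the solver.
ℚ-<-resp-difference : ∀ {p q p′ q′} → q ℚ.- p ≡ q′ ℚ.- p′ → p ℚ.< q → p′ ℚ.< q′
ℚ-<-resp-difference {p} {q} {p′} {q′} eq p<q = subst₂ ℚ._<_ lhs (p-q+q q′ p′)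
  (ℚ.+-monoˡ-< p′ (subst ((p ℚ.- p) ℚ.<_) eq (ℚ.+-monoˡ-< (ℚ.- p) p<q)))
  where
  lhs : (p ℚ.- p) ℚ.+ p′ ≡ p′
  lhs = solve 2 (λ p p′ → (p :- p) :+ p′ := p′) refl p p′

-- Rational form of x² ≤ x ⇒ x ≤ 1 with the tolerance preserved. If 1 + ε ≤ p, then p ≥ 1 and p² ≥ p
-- + pε ≥ p + ε, against the hypothesis.
p*p<p+ε⇒p<1+ε : ∀ {p ε} → 0ℚ ℚ.< ε → p ℚ.* p ℚ.< p ℚ.+ ε → p ℚ.< 1ℚ ℚ.+ ε
p*p<p+ε⇒p<1+ε {p} {ε} 0<ε p²<p+ε = ℚ.≰⇒> λ 1+ε≤p →
  let 1≤p = ℚ.≤-trans (ℚ.<⇒≤ (subst (ℚ._< 1ℚ ℚ.+ ε) (ℚ.+-identityʳ 1ℚ)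
              (ℚ.+-monoʳ-< 1ℚ 0<ε))) 1+ε≤p
  in ℚ.<-irrefl refl (begin-strict
    p ℚ.+ ε            ≡⟨ cong (p ℚ.+_) (sym (ℚ.*-identityˡ ε)) ⟩
    p ℚ.+ 1ℚ ℚ.* ε     ≤⟨ ℚ.+-monoʳ-≤ p (ℚ.*-monoʳ-≤-nonNeg ε
                            {{ℚ.nonNegative (ℚ.<⇒≤ 0<ε)}} 1≤p) ⟩
    p ℚ.+ p ℚ.* ε      ≡⟨ solve 2 (λ p ε → p :+ p :* ε := p :* (con 1ℚ :+ ε))
                            refl p ε ⟩
    p ℚ.* (1ℚ ℚ.+ ε)   ≤⟨ ℚ.*-monoˡ-≤-nonNeg p {{ℚ.nonNegative
                            (ℚ.≤-trans (ℚ.<⇒≤ (ℚ.positive⁻¹ 1ℚ)) 1≤p)}} 1+ε≤p ⟩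
    p ℚ.* p            <⟨ p²<p+ε ⟩
    p ℚ.+ ε            ∎)
  where open ℚ.≤-Reasoning

-- The bound on q gives ½ ≤ q, so an error of ½ε is at most qε. If p + ε ≤ 1, then q < pq + ½ε ≤ (p
-- + ε)q ≤ q, which is absurd.
q<p*q+½ε⇒1<p+ε : ∀ {p q ε} → 0ℚ ℚ.< ε → 1ℚ ℚ.< q ℚ.+ ½ →
  q ℚ.< p ℚ.* q ℚ.+ ½ ℚ.* ε → 1ℚ ℚ.< p ℚ.+ ε
q<p*q+½ε⇒1<p+ε {p} {q} {ε} 0<ε 1<q+½ q<pq+½ε = ℚ.≰⇒> λ p+ε≤1 →
  ℚ.<-irrefl refl (begin-strict
    q                       <⟨ q<pq+½ε ⟩
    p ℚ.* q ℚ.+ ½ ℚ.* ε     ≤⟨ ℚ.+-monoʳ-≤ (p ℚ.* q) (ℚ.*-monoʳ-≤-nonNeg ε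
                                 {{ℚ.nonNegative (ℚ.<⇒≤ 0<ε)}} ½≤q) ⟩
    p ℚ.* q ℚ.+ q ℚ.* ε     ≡⟨ solve 3 (λ p q ε →
                                 p :* q :+ q :* ε := (p :+ ε) :* q) refl p q ε ⟩
    (p ℚ.+ ε) ℚ.* q         ≤⟨ ℚ.*-monoʳ-≤-nonNeg q {{ℚ.nonNegative
                                 (ℚ.≤-trans (ℚ.<⇒≤ (ℚ.positive⁻¹ ½)) ½≤q)}} p+ε≤1 ⟩
    1ℚ ℚ.* q                ≡⟨ ℚ.*-identityˡ q ⟩
    q                       ∎)
  where
  open ℚ.≤-Reasoning
  ½≤q : ½ ℚ.≤ q
  ½≤q = ℚ.<⇒≤ (ℚ-<-resp-difference
    (solve 1 (λ q → (q :+ con ½) :- con 1ℚ := q :- con ½) refl q) 1<q+½)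

-- Real numbers

≗⇒≃ : ∀ {x y} → (∀ n → seq x n ≡ seq y n) → x ≃ y
≗⇒≃ {x} {y} x≗y ε 0<ε = 0 , λ n _ →
  subst (λ q → ℚ.∣ seq x n ℚ.- q ∣ ℚ.< ε) (x≗y n) (∣p-p∣<ε (seq x n) 0<ε)

≃-refl : ∀ {x} → x ≃ x
≃-refl {x} = ≗⇒≃ {x} {x} λ _ → refl

≃-sym : ∀ {x y} → x ≃ y → y ≃ x
≃-sym {x} {y} x≃y ε 0<ε with N , p ← x≃y ε 0<ε = N , λ n N≤n →
  subst (ℚ._< ε) (∣p-q∣≡∣q-p∣ (seq x n) (seq y n)) (p n N≤n)

≃-trans : ∀ {x y z} → x ≃ y → y ≃ z → x ≃ z
≃-trans {x} {y} {z} x≃y y≃z ε 0<ε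
  -- Each hypothesis gets half of the tolerance, and beyond the larger of the two thresholds both
  -- estimates hold.
  with M , p ← x≃y (½ ℚ.* ε) (0<½* 0<ε)
  with N , q ← y≃z (½ ℚ.* ε) (0<½* 0<ε)
  = M ℕ.⊔ N , λ n M⊔N≤n → let a = seq x n; b = seq y n; c = seq z n in
    begin-strict
    ℚ.∣ a ℚ.- c ∣
      ≡⟨ cong ℚ.∣_∣ (solve 3 (λ a b c → a :- c := (a :- b) :+ (b :- c))
           refl a b c) ⟩
    ℚ.∣ (a ℚ.- b) ℚ.+ (b ℚ.- c) ∣
      ≤⟨ ℚ.∣p+q∣≤∣p∣+∣q∣ (a ℚ.- b) (b ℚ.- c) ⟩
    ℚ.∣ a ℚ.- b ∣ ℚ.+ ℚ.∣ b ℚ.- c ∣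
      <⟨ ℚ.+-mono-< (p n (ℕ.m⊔n≤o⇒m≤o M N M⊔N≤n)) (q n (ℕ.m⊔n≤o⇒n≤o M N M⊔N≤n)) ⟩
    ½ ℚ.* ε ℚ.+ ½ ℚ.* ε
      ≡⟨ halves ε ⟩
    ε ∎
  where open ℚ.≤-Reasoning

≃⇒≤ : ∀ {x y} → x ≃ y → x ≤ y
≃⇒≤ {x} {y} x≃y ε 0<ε with N , p ← x≃y ε 0<ε = N , λ n N≤n →
  ℚ-<-resp-difference
    (solve 3 (λ a b ε → ε :- (a :- b) := (b :+ ε) :- a) refl (seq x n) (seq y n) ε)
    (ℚ.≤-<-trans (p≤∣p∣ (seq x n ℚ.- seq y n)) (p n N≤n))

≤-trans : ∀ {x y z} → x ≤ y → y ≤ z → x ≤ z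
≤-trans {x} {y} {z} x≤y y≤z ε 0<ε
  with M , p ← x≤y (½ ℚ.* ε) (0<½* 0<ε)
  with N , q ← y≤z (½ ℚ.* ε) (0<½* 0<ε)
  = M ℕ.⊔ N , λ n M⊔N≤n → begin-strict
    seq x n                                    <⟨ p n (ℕ.m⊔n≤o⇒m≤o M N M⊔N≤n) ⟩
    seq y n ℚ.+ ½ ℚ.* ε                        <⟨ ℚ.+-monoˡ-< (½ ℚ.* ε)
                                                    (q n (ℕ.m⊔n≤o⇒n≤o M N M⊔N≤n)) ⟩
    seq z n ℚ.+ ½ ℚ.* ε ℚ.+ ½ ℚ.* ε            ≡⟨ ℚ.+-assoc (seq z n) _ _ ⟩
    seq z n ℚ.+ (½ ℚ.* ε ℚ.+ ½ ℚ.* ε)          ≡⟨ cong (seq z n ℚ.+_) (halves ε) ⟩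
    seq z n ℚ.+ ε                              ∎
  where open ℚ.≤-Reasoning

+-mono-≤ : ∀ {x y u v} → x ≤ y → u ≤ v → x + u ≤ y + v
+-mono-≤ {x} {y} {u} {v} x≤y u≤v ε 0<ε
  with M , p ← x≤y (½ ℚ.* ε) (0<½* 0<ε)
  with N , q ← u≤v (½ ℚ.* ε) (0<½* 0<ε)
  = M ℕ.⊔ N , λ n M⊔N≤n →
    subst (seq x n ℚ.+ seq u n ℚ.<_) (+-halves (seq y n) (seq v n) ε)
      (ℚ.+-mono-< (p n (ℕ.m⊔n≤o⇒m≤o M N M⊔N≤n)) (q n (ℕ.m⊔n≤o⇒n≤o M N M⊔N≤n)))

-- Carries the rearrangement principle from rationals to reals: the differences agree term by term,
-- so the same threshold works for each ε.
≤-resp-difference : ∀ {x y x′ y′} →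
  (∀ n → seq y n ℚ.- seq x n ≡ seq y′ n ℚ.- seq x′ n) → x ≤ y → x′ ≤ y′
≤-resp-difference {x} {y} {x′} {y′} eq x≤y ε 0<ε with N , p ← x≤y ε 0<ε
  = N , λ n N≤n → ℚ-<-resp-difference
    (trans (swap (seq y n) ε (seq x n))
      (trans (cong (ℚ._+ ε) (eq n)) (sym (swap (seq y′ n) ε (seq x′ n)))))
    (p n N≤n)
  where
  swap : ∀ a b c → (a ℚ.+ b) ℚ.- c ≡ (a ℚ.- c) ℚ.+ b
  swap = solve 3 (λ a b c → (a :+ b) :- c := (a :- c) :+ b) refl

<-resp-difference : ∀ {x y x′ y′} →
  (∀ n → seq y n ℚ.- seq x n ≡ seq y′ n ℚ.- seq x′ n) → x < y → x′ < y′
<-resp-difference {x} {y} {x′} {y′} eq (ε , 0<ε , N , p)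
  = ε , 0<ε , N , λ n N≤n → ℚ-<-resp-difference
    (trans (regroup (seq y n) ε (seq x n))
      (trans (cong (ℚ._- ε) (eq n)) (sym (regroup (seq y′ n) ε (seq x′ n)))))
    (p n N≤n)
  where
  regroup : ∀ a b c → a ℚ.- (c ℚ.+ b) ≡ (a ℚ.- c) ℚ.- b
  regroup = solve 3 (λ a b c → a :- (c :+ b) := (a :- c) :- b) refl

-- Apply `y ≤ x` with the gap ε that witnesses `x < y`: at a common index the terms satisfy both x +
-- ε < y and y < x + ε.
<⇒≱ : ∀ {x y} → x < y → ¬ (y ≤ x)
<⇒≱ {x} {y} (ε , 0<ε , M , p) y≤x with N , q ← y≤x ε 0<ε =
  ℚ.<-asym (p (M ℕ.⊔ N) (ℕ.m≤m⊔n M N)) (q (M ℕ.⊔ N) (ℕ.m≤n⊔m M N))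

+-comm : ∀ x y → x + y ≃ y + x
+-comm x y = ≗⇒≃ {x + y} {y + x} λ n → ℚ.+-comm (seq x n) (seq y n)

x≤x+y : ∀ {x y} → 0ℝ ≤ y → x ≤ x + y
x≤x+y {x} {y} = ≤-resp-difference {0ℝ} {y} {x} {x + y} λ n →
  solve 2 (λ x y → y :- con 0ℚ := (x :+ y) :- x) refl (seq x n) (seq y n)

x≤y+x : ∀ {x y} → 0ℝ ≤ y → x ≤ y + x
x≤y+x {x} {y} = ≤-resp-difference {0ℝ} {y} {x} {y + x} λ n →
  solve 2 (λ x y → y :- con 0ℚ := (y :+ x) :- x) refl (seq x n) (seq y n)

0≤x+y : ∀ {x y} → 0ℝ ≤ x → 0ℝ ≤ y → 0ℝ ≤ x + y
0≤x+y {x} {y} 0≤x 0≤y = ≤-trans {0ℝ} {x} {x + y} 0≤x (x≤x+y {x} {y} 0≤y)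

x≤y⇒0≤y-x : ∀ {x y} → x ≤ y → 0ℝ ≤ y - x
x≤y⇒0≤y-x {x} {y} = ≤-resp-difference {x} {y} {0ℝ} {y - x} λ n →
  solve 2 (λ x y → y :- x := (y :- x) :- con 0ℚ) refl (seq x n) (seq y n)

x<y⇒0<y-x : ∀ {x y} → x < y → 0ℝ < y - x
x<y⇒0<y-x {x} {y} = <-resp-difference {x} {y} {0ℝ} {y - x} λ n →
  solve 2 (λ x y → y :- x := (y :- x) :- con 0ℚ) refl (seq x n) (seq y n)

x≤x+x⇒0≤x : ∀ {x} → x ≤ x + x → 0ℝ ≤ x
x≤x+x⇒0≤x {x} = ≤-resp-difference {x} {x + x} {0ℝ} {x} λ n →
  solve 1 (λ x → (x :+ x) :- x := x :- con 0ℚ) refl (seq x n)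

-- The rational estimate applies at each index with ε and the threshold unchanged, which avoids
-- dividing by x or knowing its sign.
x*x≤x⇒x≤1 : ∀ {x} → x * x ≤ x → x ≤ 1ℝ
x*x≤x⇒x≤1 {x} x²≤x ε 0<ε with N , p ← x²≤x ε 0<ε =
  N , λ n N≤n → p*p<p+ε⇒p<1+ε {seq x n} 0<ε (p n N≤n)

y≤x*y⇒1≤x : ∀ {x y} → 1ℝ ≤ y → y ≤ x * y → 1ℝ ≤ x
y≤x*y⇒1≤x {x} {y} 1≤y y≤xy ε 0<ε
  -- Tolerance ½ keeps the terms of y above ½ from some index on, which takes the place of dividing
  -- by y.
  with M , p ← 1≤y ½ (ℚ.positive⁻¹ ½)
  with N , q ← y≤xy (½ ℚ.* ε) (0<½* 0<ε)
  = M ℕ.⊔ N , λ n M⊔N≤n → q<p*q+½ε⇒1<p+ε {seq x n} {seq y n} 0<ε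
      (p n (ℕ.m⊔n≤o⇒m≤o M N M⊔N≤n)) (q n (ℕ.m⊔n≤o⇒n≤o M N M⊔N≤n))

-- Distances of the form F x + F y

module SumDistance {S : Set} (_≟_ : DecidableEquality S)
  (F : S → ℝ) (0≤F : ∀ x → 0ℝ ≤ F x)
  (w : S → S → ℝ) (w≃F+F : ∀ x y → w x y ≃ F x + F y) where

  -- Keeping `w` verbatim makes each instance definitionally a distance of the theorem, while the
  -- proofs see `w` only up to `_≃_`.
  d : DistanceFunction S ℝ
  d x y = if does (x ≟ y) then 0ℝ else w x y

  d-diagonal : ∀ {x y} → x ≡ y → d x y ≃ 0ℝ
  d-diagonal {x} {y} x≡y rewrite dec-true (x ≟ y) x≡y = ≃-refl {0ℝ}

  d-offDiagonal : ∀ {x y} → x ≢ y → d x y ≃ F x + F y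
  d-offDiagonal {x} {y} x≢y rewrite dec-false (x ≟ y) x≢y = w≃F+F x y

  0≤d : ∀ x y → 0ℝ ≤ d x y
  0≤d x y with x ≟ y
  ... | yes _ = ≃⇒≤ {0ℝ} {0ℝ} (≃-refl {0ℝ})
  ... | no  _ = ≤-trans {0ℝ} {F x + F y} {w x y}
    (0≤x+y {F x} {F y} (0≤F x) (0≤F y))
    (≃⇒≤ {F x + F y} {w x y} (≃-sym {w x y} {F x + F y} (w≃F+F x y)))

  d-sym : ∀ x y → d x y ≃ d y x
  d-sym x y with x ≟ y
  ... | yes x≡y = ≃-sym {d y x} {0ℝ} (d-diagonal (sym x≡y))
  ... | no  x≢y = ≃-trans {w x y} {F x + F y} {d y x} (w≃F+F x y)
    (≃-trans {F x + F y} {F y + F x} {d y x} (+-comm (F x) (F y))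
      (≃-sym {d y x} {F y + F x} (d-offDiagonal λ y≡x → x≢y (sym y≡x))))

  -- For three distinct points, F x is at most the first summand and F z at most the second, the
  -- surplus being F y twice. If two of the points coincide, nonnegativity of d is enough.
  d-triangle : ∀ x y z → d x z ≤ d x y + d y z
  d-triangle x y z = by-cases (x ≟ y) (y ≟ z) (x ≟ z)
    where
    by-cases : Dec (x ≡ y) → Dec (y ≡ z) → Dec (x ≡ z) → d x z ≤ d x y + d y z
    -- Here the right side is `d x x + d x z`; its first summand only has to be nonnegative and is
    -- never evaluated.
    by-cases (yes refl) _ _ = x≤y+x {d x z} {d x x} (0≤d x x)
    by-cases (no _) (yes refl) _ = x≤x+y {d x z} {d z z} (0≤d z z)
    by-cases (no _) (no _) (yes x≡z) = ≤-trans {d x z} {0ℝ} {d x y + d y z}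
      (≃⇒≤ {d x z} {0ℝ} (d-diagonal x≡z))
      (0≤x+y {d x y} {d y z} (0≤d x y) (0≤d y z))
    by-cases (no x≢y) (no y≢z) (no x≢z) =
      ≤-trans {d x z} {F x + F z} {d x y + d y z}
        (≃⇒≤ {d x z} {F x + F z} (d-offDiagonal x≢z))
        (+-mono-≤ {F x} {d x y} {F z} {d y z}
          (≤-trans {F x} {F x + F y} {d x y} (x≤x+y {F x} {F y} (0≤F y))
            (≃⇒≤ {F x + F y} {d x y} (≃-sym {d x y} {F x + F y} (d-offDiagonal x≢y))))
          (≤-trans {F z} {F y + F z} {d y z} (x≤y+x {F z} {F y} (0≤F y))
            (≃⇒≤ {F y + F z} {d y z} (≃-sym {d y z} {F y + F z} (d-offDiagonal y≢z)))))

  d-isPseudometric : IsPseudometric d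
  d-isPseudometric = record
    { d[x,x]≃0  = λ x → d-diagonal {x} refl
    ; symmetric = d-sym
    ; triangle  = d-triangle
    }

  -- Strict positivity at one of the two points suffices: if d vanished, F x ≤ F x + F y ≤ 0 would
  -- follow, and likewise for F y.
  d-separates : ∀ {x y} → x ≢ y → 0ℝ < F x ⊎ 0ℝ < F y → ¬ (d x y ≃ 0ℝ)
  d-separates {x} {y} x≢y 0<F d≃0 = [ left , right ]′ 0<F
    where
    F+F≤0 : F x + F y ≤ 0ℝ
    F+F≤0 = ≃⇒≤ {F x + F y} {0ℝ} (≃-trans {F x + F y} {d x y} {0ℝ}
      (≃-sym {d x y} {F x + F y} (d-offDiagonal x≢y)) d≃0)
    left : ¬ (0ℝ < F x)
    left 0<Fx = <⇒≱ {0ℝ} {F x} 0<Fx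
      (≤-trans {F x} {F x + F y} {0ℝ} (x≤x+y {F x} {F y} (0≤F y)) F+F≤0)
    right : ¬ (0ℝ < F y)
    right 0<Fy = <⇒≱ {0ℝ} {F y} 0<Fy
      (≤-trans {F y} {F x + F y} {0ℝ} (x≤y+x {F y} {F x} (0≤F x)) F+F≤0)

-- Pseudometrics along a map, and distances through the gcd with n

isPseudometric-on : ∀ {S T : Set} {d : DistanceFunction T ℝ} (φ : S → T) →
  IsPseudometric d → IsPseudometric (d on φ)
isPseudometric-on φ isP = record
  { d[x,x]≃0  = λ x → d[x,x]≃0 (φ x)
  ; symmetric = λ x y → symmetric (φ x) (φ y)
  ; triangle  = λ x y z → triangle (φ x) (φ y) (φ z)
  }
  where open IsPseudometric isP

m∣n⇒gcd≡m : ∀ {m n} → m ∣ n → gcd m n ≡ m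
m∣n⇒gcd≡m {m} {n} m∣n = ∣-antisym (gcd[m,n]∣m m n) (gcd-greatest ∣-refl m∣n)

module GcdDistance (n : ℕ) .{{_ : NonZero n}}
  (F : ArithmeticFunction) (0≤F : ∀ x .{{_ : NonZero x}} → 0ℝ ≤ F x)
  (w : ℤ → ℤ → ℝ) (w≃F+F : ∀ x y → w x y ≃ atGcd n F x + atGcd n F y) where

  gcd≢0 : ∀ x → NonZero (gcd ℤ.∣ x ∣ n)
  gcd≢0 x = ℕ.≢-nonZero (gcd[m,n]≢0 ℤ.∣ x ∣ n (inj₂ (ℕ.≢-nonZero⁻¹ n)))

  open SumDistance ℤ._≟_ (atGcd n F) (λ x → 0≤F _ {{gcd≢0 x}}) w w≃F+F public

  gcd-value : (v : D n) → gcd (value v) n ≡ value v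
  -- The divisibility proof in an element of `D n` is irrelevant; as equality on ℕ is decidable,
  -- `recompute` still yields a usable equation.
  gcd-value (k , [ p ]) = recompute (gcd k n ℕ.≟ k) (m∣n⇒gcd≡m (proj₂ p))

  d-isMetric : (∀ x .{{_ : NonZero x}} → x > 1 → 0ℝ < F x) →
    IsMetric (restrict n d)
  d-isMetric 0<F = record
    { isPseudometric = isPseudometric-on (λ v → ℤ.+ value v) d-isPseudometric
    ; indiscernable  = indiscernable
    }
    where
    0<F-value : (v : D n) → value v ≢ 1 → 0ℝ < atGcd n F (ℤ.+ value v)
    -- The gcd with n is nonzero and, being equal to `value v`, differs from 1; hence it exceeds 1.
    0<F-value v v≢1 = 0<F _ {{gcd≢0 (ℤ.+ value v)}} (ℕ.≤∧≢⇒<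
      (ℕ.>-nonZero⁻¹ _ {{gcd≢0 (ℤ.+ value v)}})
      λ 1≡gcd → v≢1 (trans (sym (gcd-value v)) (sym 1≡gcd)))

    someValue>1 : (u v : D n) → value u ≢ value v →
      0ℝ < atGcd n F (ℤ.+ value u) ⊎ 0ℝ < atGcd n F (ℤ.+ value v)
    -- Two distinct values cannot both be 1, so testing the first one decides where positivity is
    -- available.
    someValue>1 u v u≢v with value u ℕ.≟ 1
    ... | yes u≡1 = inj₂ (0<F-value v λ v≡1 → u≢v (trans u≡1 (sym v≡1)))
    ... | no  u≢1 = inj₁ (0<F-value u u≢1)

    indiscernable : ∀ {u v : D n} → restrict n d u v ≃ 0ℝ → u ≡ v
    -- `d-separates` only refutes, so equality of the underlying integers is decided first.
    indiscernable {u} {v} d≃0 with value u ℕ.≟ value v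
    ... | yes u≡v = value-injective u≡v
    ... | no  u≢v = contradiction d≃0
      (d-separates (λ eq → u≢v (ℤ.+-injective eq)) (someValue>1 u v u≢v))

-- Values at 1

at1∧>1⇒all : ∀ {P : (x : ℕ) .{{_ : NonZero x}} → Set} → P 1 →
  (∀ x .{{_ : NonZero x}} → x > 1 → P x) → ∀ x .{{_ : NonZero x}} → P x
-- The missing case 0 is excluded by the `NonZero` instance.
at1∧>1⇒all P1 P>1 1 = P1
at1∧>1⇒all P1 P>1 (ℕ.suc (ℕ.suc x)) = P>1 _ (ℕ.s≤s (ℕ.s≤s ℕ.z≤n))

𝒜⇒0≤f : ∀ {f} → 𝒜 f → ∀ x .{{_ : NonZero x}} → 0ℝ ≤ f x
𝒜⇒0≤f {f} (additive , 0≤f) = at1∧>1⇒all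
  (x≤x+x⇒0≤x {f 1} (≃⇒≤ {f 1} {f 1 + f 1} (additive 1 1 (1-coprimeTo 1)))) 0≤f

-- The equation g 1 = g 1 g 1 alone would admit the value 0. Comparing with g 2 ≥ 1 through g 2 = g
-- 1 g 2 gives the lower bound directly.
ℳ⇒1≤g : ∀ {g} → ℳ g → ∀ x .{{_ : NonZero x}} → 1ℝ ≤ g x
ℳ⇒1≤g {g} ((_ , multiplicative) , 1≤g) = at1∧>1⇒all
  (y≤x*y⇒1≤x {g 1} {g 2} (1≤g 2 ℕ.≤-refl)
    (≃⇒≤ {g 2} {g 1 * g 2} (multiplicative 1 2 (1-coprimeTo 2)))) 1≤g

-- For an upper bound h 1 = h 1 h 1 is enough, since both of its solutions 0 and 1 are at most 1.
ℐ⇒h≤1 : ∀ {h} → ℐ h → ∀ x .{{_ : NonZero x}} → h x ≤ 1ℝ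
ℐ⇒h≤1 {h} ((_ , multiplicative) , 0≤h≤1) = at1∧>1⇒all
  (x*x≤x⇒x≤1 {h 1} (≃⇒≤ {h 1 * h 1} {h 1}
    (≃-sym {h 1} {h 1 * h 1} (multiplicative 1 1 (1-coprimeTo 1)))))
  λ x x>1 → proj₂ (0≤h≤1 x x>1)

theorem3p6 : (n : ℕ) .{{_ : NonZero n}} → n > 1 →
    (f g h : ArithmeticFunction) → 𝒜 f → ℳ g → ℐ h →
    (IsPseudometric (d⁺-𝒜 n f) ×
    IsPseudometric (d⁺-ℳ n g) ×
    IsPseudometric (d⁺-ℐ n h)) ×
    (IsPseudometric (restrict n (d⁺-𝒜 n f)) ×
    IsPseudometric (restrict n (d⁺-ℳ n g)) ×
    IsPseudometric (restrict n (d⁺-ℐ n h))) ×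
    (𝒜₀ f → IsMetric (restrict n (d⁺-𝒜 n f))) ×
    (ℳ₁ g → IsMetric (restrict n (d⁺-ℳ n g))) ×
    (ℐ₁ h → IsMetric (restrict n (d⁺-ℐ n h)))
theorem3p6 n _ f g h f∈𝒜 g∈ℳ h∈ℐ =
  (Df.d-isPseudometric , Dg.d-isPseudometric , Dh.d-isPseudometric) ,
  ( isPseudometric-on D→ℤ Df.d-isPseudometric
  , isPseudometric-on D→ℤ Dg.d-isPseudometric
  , isPseudometric-on D→ℤ Dh.d-isPseudometric ) ,
  (λ f∈𝒜₀ → Df.d-isMetric (proj₂ f∈𝒜₀)) ,
  (λ g∈ℳ₁ → Dg.d-isMetric λ x x>1 → x<y⇒0<y-x {1ℝ} {g x} (proj₂ g∈ℳ₁ x x>1)) ,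
  (λ h∈ℐ₁ → Dh.d-isMetric λ x x>1 →
    x<y⇒0<y-x {h x} {1ℝ} (proj₂ (proj₂ h∈ℐ₁ x x>1)))
  where
  D→ℤ : D n → ℤ
  D→ℤ v = ℤ.+ value v

  module Df = GcdDistance n f (𝒜⇒0≤f {f} f∈𝒜)
    (λ x y → atGcd n f x + atGcd n f y)
    (λ x y → ≃-refl {atGcd n f x + atGcd n f y})

  module Dg = GcdDistance n (λ x → g x - 1ℝ)
    (λ x → x≤y⇒0≤y-x {1ℝ} {g x} (ℳ⇒1≤g {g} g∈ℳ x))
    (λ x y → atGcd n g x + atGcd n g y - 2ℝ)
    -- `2ℝ` is the constant sequence 1 + 1, so one unit goes to each summand and the two sides agree
    -- term by term.
    (λ x y → ≗⇒≃ {atGcd n g x + atGcd n g y - 2ℝ}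
      {(atGcd n g x - 1ℝ) + (atGcd n g y - 1ℝ)} λ k →
      solve 2 (λ a b → (a :+ b) :- con (1ℚ ℚ.+ 1ℚ)
                    := (a :- con 1ℚ) :+ (b :- con 1ℚ))
        refl (seq (atGcd n g x) k) (seq (atGcd n g y) k))

  module Dh = GcdDistance n (λ x → 1ℝ - h x)
    (λ x → x≤y⇒0≤y-x {h x} {1ℝ} (ℐ⇒h≤1 {h} h∈ℐ x))
    (λ x y → 2ℝ - atGcd n h x - atGcd n h y)
    (λ x y → ≗⇒≃ {2ℝ - atGcd n h x - atGcd n h y}
      {(1ℝ - atGcd n h x) + (1ℝ - atGcd n h y)} λ k →
      solve 2 (λ a b → (con (1ℚ ℚ.+ 1ℚ) :- a) :- b
                    := (con 1ℚ :- a) :+ (con 1ℚ :- b))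
        refl (seq (atGcd n h x) k) (seq (atGcd n h y) k))
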